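{- There is a $2$-adic integer $K$ such that, for all positive integers $d$ and all integers $e>d$, $$\operatorname{uns}(e,d)+K\equiv \operatorname{stab}(e+1,d)\pmod{2^d}.$$
   Context: For a positive integer $n$, $\nu(n)$ is the exponent of $2$ in the prime factorization of $n$, and $\operatorname{od}(n)=n/2^{\nu(n)}$ is the odd part of $n$. The notation $2^e!$ means $(2^e)!$. Let $z$ be the $2$-adic integer $\lim_{e\to\infty}\operatorname{od}(2^e!)$ ($2$-adic limit); it is known to exist and to satisfy $z\equiv\operatorname{od}(2^{e-1}!)\pmod{2^e}$ for all $e\ge3$. The bit in position $i$ of a ($2$-adic) integer is the coefficient of $2^i$ in its binary expansion. $\operatorname{uns}(e,d)=\sum_{i=0}^{d-1}u_i2^i$, where $u_i$ is the bit of $\operatorname{od}(2^e!)$ in position $e+1+i$ (i.e. the number formed by the bits of $\operatorname{od}(2^e!)$ in positions $e+1,\dots,e+d$). $\operatorname{stab}(e+1,d)=\sum_{i=0}^{d-1}s_i2^i$, where $s_i$ is the bit of $z$ in position $e+1+i$ (i.e. the number formed by the bits of $z$ in positions $e+1,\dots,e+d$). -}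

module Defs where

open import Data.List.Base using (applyUpTo; filter; length)
open import Data.Nat.Base
open import Data.Nat.DivMod using (%-distribˡ-+)
open import Data.Nat.ListAction using (sum)
open import Data.Nat.Primality.Factorisation using (factorise; factors)
open import Data.Nat.Properties using (_≟_; _!≢0; m^n≢0)
open import Data.Product.Base using (∃-syntax)
open import Relation.Binary.PropositionalEquality

ν : (n : ℕ) → .{{NonZero n}} → ℕ
ν n = length (filter (2 ≟_) (factors (factorise n)))

infixl 7 _div2^_ _mod2^_

_div2^_ : ℕ → ℕ → ℕ
n div2^ k = _/_ n (2 ^ k) {{m^n≢0 2 k}}

_mod2^_ : ℕ → ℕ → ℕ
n mod2^ k = _%_ n (2 ^ k) {{m^n≢0 2 k}}

od : (n : ℕ) → .{{NonZero n}} → ℕ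
od n = n div2^ ν n

od2^_! : ℕ → ℕ
od2^ e ! = od ((2 ^ e) !) {{(2 ^ e) !≢0}}

-- ℤ₂ as the inverse limit of the rings ℤ/2ᵏ.  Quotient-free encoding:
-- residue k is any natural number representing the class modulo 2ᵏ, not
-- necessarily the one below 2ᵏ, so propositional equality of records is not
-- equality of 2-adic integers; everything below depends on residue k only
-- through its class modulo 2ᵏ.
record ℤ₂ : Set where
  field
    residue  : ℕ → ℕ
    coherent : ∀ k → residue (suc k) mod2^ k ≡ residue k mod2^ k

open ℤ₂ public

-- The kernel of ℤ₂ → ℤ/2ᵏ is 2ᵏℤ₂, so this is congruence modulo 2ᵏ in ℤ₂.
infix 4 _≡₂_[mod2^_]

_≡₂_[mod2^_] : ℤ₂ → ℤ₂ → ℕ → Set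
x ≡₂ y [mod2^ k ] = residue x k mod2^ k ≡ residue y k mod2^ k

fromℕ : ℕ → ℤ₂
fromℕ n = record { residue = λ _ → n ; coherent = λ _ → refl }

infixl 6 _+₂_

_+₂_ : ℤ₂ → ℤ₂ → ℤ₂
residue (x +₂ y) k = residue x k + residue y k
coherent (x +₂ y) k = begin
  (residue x (suc k) + residue y (suc k)) mod2^ k
    ≡⟨ distrib (residue x (suc k)) (residue y (suc k)) ⟩
  (residue x (suc k) mod2^ k + residue y (suc k) mod2^ k) mod2^ k
    ≡⟨ cong₂ (λ a b → (a + b) mod2^ k) (coherent x k) (coherent y k) ⟩
  (residue x k mod2^ k + residue y k mod2^ k) mod2^ k
    ≡⟨ distrib (residue x k) (residue y k) ⟨
  (residue x k + residue y k) mod2^ k ∎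
  where
  open ≡-Reasoning
  distrib : ∀ a b → (a + b) mod2^ k ≡ (a mod2^ k + b mod2^ k) mod2^ k
  distrib a b = %-distribˡ-+ a b (2 ^ k) {{m^n≢0 2 k}}

-- 2-adic convergence: |x - y|₂ ≤ 2⁻ᵏ means x ≡ y modulo 2ᵏ.
_IsLimitOf_ : ℤ₂ → (ℕ → ℕ) → Set
z IsLimitOf a = ∀ k → ∃[ N ] (∀ e → N ≤ e → fromℕ (a e) ≡₂ z [mod2^ k ])

bit : ℕ → ℕ → ℕ
bit n i = (n div2^ i) % 2

-- The bit in position i is determined by the class modulo 2ⁱ⁺¹.
bit₂ : ℤ₂ → ℕ → ℕ
bit₂ x i = bit (residue x (suc i)) i

uns : ℕ → ℕ → ℕ
uns e d = sum (applyUpTo (λ i → bit (od2^ e !) (e + 1 + i) * 2 ^ i) d)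

-- The first argument is the starting position, so that e + 1 selects the
-- bits in positions e + 1, …, e + d.
stab : ℤ₂ → ℕ → ℕ → ℕ
stab z m d = sum (applyUpTo (λ i → bit₂ z (m + i) * 2 ^ i) d)

{-# OPTIONS --safe #-}
-- Write A e = od(2ᵉ!) and let O e be the product of the odd numbers below
-- 2ᵉ⁺¹, so that A (e+1) = A e · O e.  Put q = 2ᵉ⁺¹.  Pairing i with q - i below
-- q, and q + i with 2q - i above q, gives O (e+1) ≡ (O e)² modulo 2q², hence
-- O e ≡ 1 modulo q for e ≥ 2.  Because x³ - 3x + 2 = (x - 1)²(x + 2), the
-- extrapolated sequence 2 A e - A (e+1) is then constant modulo q² from index e
-- on, so z ≡ 2 A e - A (e+1) modulo q².  On the other hand z and A e agree
-- modulo q, so z - A e ≡ q (stab - uns) modulo q 2ᵈ; comparing this for e and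
-- e+1 shows that stab - uns modulo 2ᵈ does not depend on e > d, and K is made
-- of these common values.
module Submission where

open import Data.Integer.Base as ℤ using (ℤ; +_; -[1+_]; 0ℤ; 1ℤ)
import Data.Integer.DivMod as ℤ
import Data.Integer.Properties as ℤ
import Data.Integer.Tactic.RingSolver as ℤ-Solver
open import Data.List.Base using ([]; _∷_; _++_; applyUpTo; filter; length)
open import Data.List.Properties using (applyUpTo-∷ʳ; filter-accept; filter-reject)
open import Data.List.Relation.Unary.All using (All; []; _∷_)
open import Data.Nat.Base
open import Data.Nat.DivMod
open import Data.Nat.Divisibility using (_∣_; _∤_; m∣m*n; ∣1⇒≡1; ∣m+n∣m⇒∣n)
open import Data.Nat.ListAction using (sum; product)
open import Data.Nat.ListAction.Properties using (sum-++)
open import Data.Nat.Primality using (Prime; prime[2]; euclidsLemma; prime⇒irreducible)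
open import Data.Nat.Primality.Factorisation using (factorise; module PrimeFactorisation)
open import Data.Nat.Properties
import Data.Nat.Tactic.RingSolver as ℕ-Solver
open import Data.Product.Base using (∃-syntax; _×_; _,_; proj₁; proj₂)
open import Data.Sum.Base using (inj₁; inj₂)
open import Relation.Binary.PropositionalEquality
open import Relation.Nullary using (yes; no; contradiction)
open import Defs

-- Uniqueness of the odd part.

2∤1 : 2 ∤ 1
2∤1 2∣1 with () ← ∣1⇒≡1 2∣1

∤-* : ∀ m n → 2 ∤ m → 2 ∤ n → 2 ∤ m * n
∤-* m n 2∤m 2∤n 2∣mn with euclidsLemma m n prime[2] 2∣mn
... | inj₁ 2∣m = 2∤m 2∣m
... | inj₂ 2∣n = 2∤n 2∣n

-- Factors of 2 are stripped from both sides at once; if one exponent runs out first, an odd number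
-- would be even.
odd-cofactor-unique : ∀ a b {u v} → 2 ∤ u → 2 ∤ v → 2 ^ a * u ≡ 2 ^ b * v → u ≡ v
odd-cofactor-unique zero zero {u} {v} _ _ eq =
  trans (sym (*-identityˡ u)) (trans eq (*-identityˡ v))
odd-cofactor-unique zero (suc b) {u} {v} 2∤u _ eq = contradiction
  (subst (2 ∣_) (trans (sym (*-assoc 2 (2 ^ b) v)) (trans (sym eq) (*-identityˡ u))) (m∣m*n (2 ^ b * v)))
  2∤u
odd-cofactor-unique (suc a) zero {u} {v} _ 2∤v eq = contradiction
  (subst (2 ∣_) (trans (sym (*-assoc 2 (2 ^ a) u)) (trans eq (*-identityˡ v))) (m∣m*n (2 ^ a * u)))
  2∤v
odd-cofactor-unique (suc a) (suc b) {u} {v} 2∤u 2∤v eq = odd-cofactor-unique a b 2∤u 2∤v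
  (*-cancelˡ-≡ (2 ^ a * u) (2 ^ b * v) 2
    (trans (sym (*-assoc 2 (2 ^ a) u)) (trans eq (*-assoc 2 (2 ^ b) v))))

-- The witness collects the primes other than 2: by irreducibility each of them is odd, and Euclid's
-- lemma keeps their product odd.
product-split : ∀ {ps} → All Prime ps →
  ∃[ u ] (2 ∤ u × product ps ≡ 2 ^ length (filter (2 ≟_) ps) * u)
product-split [] = 1 , 2∤1 , refl
product-split {p ∷ ps} (prime[p] ∷ rest) with product-split rest | 2 ≟ p
... | u , 2∤u , eq | yes 2≡p = u , 2∤u , (begin
  p * product ps                             ≡⟨ cong₂ _*_ (sym 2≡p) eq ⟩
  2 * (2 ^ length (filter (2 ≟_) ps) * u)    ≡⟨ *-assoc 2 (2 ^ length (filter (2 ≟_) ps)) u ⟨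
  2 ^ suc (length (filter (2 ≟_) ps)) * u    ≡⟨ cong (λ l → 2 ^ length l * u) (filter-accept (2 ≟_) 2≡p) ⟨
  2 ^ length (filter (2 ≟_) (p ∷ ps)) * u    ∎)
  where open ≡-Reasoning
... | u , 2∤u , eq | no 2≢p = p * u , ∤-* p u 2∤p 2∤u , (begin
  p * product ps                                 ≡⟨ cong (p *_) eq ⟩
  p * (2 ^ length (filter (2 ≟_) ps) * u)        ≡⟨ swap p (2 ^ length (filter (2 ≟_) ps)) u ⟩
  2 ^ length (filter (2 ≟_) ps) * (p * u)        ≡⟨ cong (λ l → 2 ^ length l * (p * u)) (filter-reject (2 ≟_) 2≢p) ⟨
  2 ^ length (filter (2 ≟_) (p ∷ ps)) * (p * u)  ∎)
  where
  open ≡-Reasoning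
  swap : ∀ a b c → a * (b * c) ≡ b * (a * c)
  swap = ℕ-Solver.solve-∀
  2∤p : 2 ∤ p
  2∤p 2∣p with prime⇒irreducible prime[p] 2∣p
  ... | inj₂ 2≡p = 2≢p 2≡p

od-spec : ∀ n .{{_ : NonZero n}} → 2 ∤ od n × n ≡ 2 ^ ν n * od n
od-spec n = subst (λ v → 2 ∤ v × n ≡ 2 ^ ν n * v) (sym od≡u) (2∤u , n≡)
  where
  open PrimeFactorisation (factorise n)
  u = proj₁ (product-split factorsPrime)
  2∤u = proj₁ (proj₂ (product-split factorsPrime))
  n≡ : n ≡ 2 ^ ν n * u
  n≡ = trans isFactorisation (proj₂ (proj₂ (product-split factorsPrime)))
  instance _ = m^n≢0 2 (ν n)
  od≡u : od n ≡ u
  od≡u = begin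
    n / 2 ^ ν n              ≡⟨ /-congˡ {o = 2 ^ ν n} (trans n≡ (*-comm (2 ^ ν n) u)) ⟩
    (u * 2 ^ ν n) / 2 ^ ν n  ≡⟨ m*n/n≡m u (2 ^ ν n) ⟩
    u                        ∎
    where open ≡-Reasoning

-- Any way of writing `n` as a power of 2 times an odd number yields `od n`, so factorials can be
-- treated without evaluating `ν` on them.
od-unique : ∀ n .{{_ : NonZero n}} k {u} → 2 ∤ u → n ≡ 2 ^ k * u → od n ≡ u
od-unique n k 2∤u eq =
  odd-cofactor-unique (ν n) k (proj₁ (od-spec n)) 2∤u (trans (sym (proj₂ (od-spec n))) eq)

-- Double factorials (2n - 1)!! and the recursion for the odd part of (2ᵉ)!.

oddFactorial : ℕ → ℕ
oddFactorial zero    = 1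
oddFactorial (suc n) = oddFactorial n * (1 + 2 * n)

2∤oddFactorial : ∀ n → 2 ∤ oddFactorial n
2∤oddFactorial zero    = 2∤1
2∤oddFactorial (suc n) = ∤-* (oddFactorial n) (1 + 2 * n) (2∤oddFactorial n)
  λ 2∣1+2n → 2∤1 (∣m+n∣m⇒∣n (subst (2 ∣_) (+-comm 1 (2 * n)) 2∣1+2n) (m∣m*n n))

-- The even factors of (2n)! contribute 2ⁿ n!, the odd ones the double factorial.
[2n]! : ∀ n → (2 * n) ! ≡ 2 ^ n * (n ! * oddFactorial n)
[2n]! zero    = refl
[2n]! (suc n) = begin
  (2 * suc n) !
    ≡⟨ cong _! (*-suc 2 n) ⟩
  (2 + 2 * n) * ((1 + 2 * n) * (2 * n) !)
    ≡⟨ cong (λ m → (2 + 2 * n) * ((1 + 2 * n) * m)) ([2n]! n) ⟩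
  (2 + 2 * n) * ((1 + 2 * n) * (2 ^ n * (n ! * oddFactorial n)))
    ≡⟨ rearrange n (2 ^ n) (n !) (oddFactorial n) ⟩
  2 ^ suc n * (suc n ! * oddFactorial (suc n)) ∎
  where
  open ≡-Reasoning
  rearrange : ∀ n t f o → (2 + 2 * n) * ((1 + 2 * n) * (t * (f * o)))
                        ≡ 2 * t * ((1 + n) * f * (o * (1 + 2 * n)))
  rearrange = ℕ-Solver.solve-∀

od2^-suc : ∀ e → od2^ suc e ! ≡ od2^ e ! * oddFactorial (2 ^ e)
od2^-suc e = od-unique ((2 ^ suc e) !) {{(2 ^ suc e) !≢0}} (2 ^ e + k)
  (∤-* (od2^ e !) (oddFactorial (2 ^ e)) (proj₁ spec) (2∤oddFactorial (2 ^ e)))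
  (begin
    (2 ^ suc e) !
      ≡⟨ [2n]! (2 ^ e) ⟩
    2 ^ 2 ^ e * ((2 ^ e) ! * oddFactorial (2 ^ e))
      ≡⟨ cong (λ f → 2 ^ 2 ^ e * (f * oddFactorial (2 ^ e))) (proj₂ spec) ⟩
    2 ^ 2 ^ e * (2 ^ k * od2^ e ! * oddFactorial (2 ^ e))
      ≡⟨ rearrange (2 ^ 2 ^ e) (2 ^ k) (od2^ e !) (oddFactorial (2 ^ e)) ⟩
    2 ^ 2 ^ e * 2 ^ k * (od2^ e ! * oddFactorial (2 ^ e))
      ≡⟨ cong (_* (od2^ e ! * oddFactorial (2 ^ e))) (^-distribˡ-+-* 2 (2 ^ e) k) ⟨
    2 ^ (2 ^ e + k) * (od2^ e ! * oddFactorial (2 ^ e)) ∎)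
  where
  open ≡-Reasoning
  instance _ = (2 ^ e) !≢0
  k = ν ((2 ^ e) !)
  spec = od-spec ((2 ^ e) !)
  rearrange : ∀ a b c d → a * (b * c * d) ≡ a * b * (c * d)
  rearrange = ℕ-Solver.solve-∀


-- Congruences of integers.

infix 4 _≈_[mod_]

-- The quotient is kept as data, so that matching on `by q refl` reduces the congruence laws to ring
-- identities.
record _≈_[mod_] (x y n : ℤ) : Set where
  constructor by
  field
    quotient : ℤ
    equality : x ≡ y ℤ.+ quotient ℤ.* n

≈-refl : ∀ {x n} → x ≈ x [mod n ]
≈-refl {x} {n} = by 0ℤ (ring x n)
  where
  ring : ∀ x n → x ≡ x ℤ.+ 0ℤ ℤ.* n
  ring = ℤ-Solver.solve-∀

≈-reflexive : ∀ {x y n} → x ≡ y → x ≈ y [mod n ]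
≈-reflexive refl = ≈-refl

≈-sym : ∀ {x y n} → x ≈ y [mod n ] → y ≈ x [mod n ]
≈-sym {_} {y} {n} (by q eq) =
  by (ℤ.- q) (trans (ring y q n) (cong (ℤ._+ ℤ.- q ℤ.* n) (sym eq)))
  where
  ring : ∀ y q n → y ≡ y ℤ.+ q ℤ.* n ℤ.+ ℤ.- q ℤ.* n
  ring = ℤ-Solver.solve-∀

≈-trans : ∀ {x y z n} → x ≈ y [mod n ] → y ≈ z [mod n ] → x ≈ z [mod n ]
≈-trans {z = z} {n} (by q refl) (by r refl) = by (q ℤ.+ r) (ring z q r n)
  where
  ring : ∀ z q r n → z ℤ.+ r ℤ.* n ℤ.+ q ℤ.* n ≡ z ℤ.+ (q ℤ.+ r) ℤ.* n
  ring = ℤ-Solver.solve-∀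

≈-+ : ∀ {x y x′ y′ n} → x ≈ y [mod n ] → x′ ≈ y′ [mod n ] → x ℤ.+ x′ ≈ y ℤ.+ y′ [mod n ]
≈-+ {y = y} {y′ = y′} {n} (by q refl) (by r refl) = by (q ℤ.+ r) (ring y y′ q r n)
  where
  ring : ∀ y y′ q r n →
    y ℤ.+ q ℤ.* n ℤ.+ (y′ ℤ.+ r ℤ.* n) ≡ y ℤ.+ y′ ℤ.+ (q ℤ.+ r) ℤ.* n
  ring = ℤ-Solver.solve-∀

≈-* : ∀ {x y x′ y′ n} → x ≈ y [mod n ] → x′ ≈ y′ [mod n ] → x ℤ.* x′ ≈ y ℤ.* y′ [mod n ]
≈-* {y = y} {y′ = y′} {n} (by q refl) (by r refl) =
  by (q ℤ.* y′ ℤ.+ r ℤ.* y ℤ.+ q ℤ.* r ℤ.* n) (ring y y′ q r n)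
  where
  ring : ∀ y y′ q r n →
    (y ℤ.+ q ℤ.* n) ℤ.* (y′ ℤ.+ r ℤ.* n)
    ≡ y ℤ.* y′ ℤ.+ (q ℤ.* y′ ℤ.+ r ℤ.* y ℤ.+ q ℤ.* r ℤ.* n) ℤ.* n
  ring = ℤ-Solver.solve-∀

≈-neg : ∀ {x y n} → x ≈ y [mod n ] → ℤ.- x ≈ ℤ.- y [mod n ]
≈-neg {_} {y} {n} (by q refl) = by (ℤ.- q) (ring y q n)
  where
  ring : ∀ y q n → ℤ.- (y ℤ.+ q ℤ.* n) ≡ ℤ.- y ℤ.+ ℤ.- q ℤ.* n
  ring = ℤ-Solver.solve-∀

≈-factor : ∀ {x y m n} → x ≈ y [mod m ℤ.* n ] → x ≈ y [mod m ]
≈-factor {_} {y} {m} {n} (by q refl) = by (q ℤ.* n) (ring y q m n)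
  where
  ring : ∀ y q m n → y ℤ.+ q ℤ.* (m ℤ.* n) ≡ y ℤ.+ q ℤ.* n ℤ.* m
  ring = ℤ-Solver.solve-∀

2^-+ : ∀ m n → + (2 ^ (m + n)) ≡ + (2 ^ m) ℤ.* + (2 ^ n)
2^-+ m n = trans (cong +_ (^-distribˡ-+-* 2 m n)) (ℤ.pos-* (2 ^ m) (2 ^ n))

≈-weaken : ∀ {x y k l} → k ≤ l → x ≈ y [mod + (2 ^ l) ] → x ≈ y [mod + (2 ^ k) ]
≈-weaken {x} {y} {k} k≤l x≈y with o , refl ← m≤n⇒∃[o]m+o≡n k≤l =
  ≈-factor (subst (λ n → x ≈ y [mod n ]) (2^-+ k o) x≈y)

≈-telescope : (a : ℕ → ℤ) {n : ℤ} (e : ℕ) →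
  (∀ f → e ≤ f → a (suc f) ≈ a f [mod n ]) → ∀ k → a (k + e) ≈ a e [mod n ]
≈-telescope a e step zero    = ≈-refl
≈-telescope a e step (suc k) =
  ≈-trans (step (k + e) (m≤n+m e k)) (≈-telescope a e step k)

%≡%⇒≈ : ∀ a b n .{{_ : NonZero n}} → a % n ≡ b % n → + a ≈ + b [mod + n ]
%≡%⇒≈ a b n eq = by (+ (a / n) ℤ.- + (b / n)) (begin
  + a
    ≡⟨ decompose a ⟩
  + (a % n) ℤ.+ + (a / n) ℤ.* + n
    ≡⟨ cong (λ r → + r ℤ.+ + (a / n) ℤ.* + n) eq ⟩
  + (b % n) ℤ.+ + (a / n) ℤ.* + n
    ≡⟨ ring (+ (b % n)) (+ (a / n)) (+ (b / n)) (+ n) ⟩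
  + (b % n) ℤ.+ + (b / n) ℤ.* + n ℤ.+ (+ (a / n) ℤ.- + (b / n)) ℤ.* + n
    ≡⟨ cong (ℤ._+ (+ (a / n) ℤ.- + (b / n)) ℤ.* + n) (decompose b) ⟨
  + b ℤ.+ (+ (a / n) ℤ.- + (b / n)) ℤ.* + n ∎)
  where
  open ≡-Reasoning
  decompose : ∀ m → + m ≡ + (m % n) ℤ.+ + (m / n) ℤ.* + n
  decompose m = trans (cong +_ (m≡m%n+[m/n]*n m n))
    (cong (λ i → + (m % n) ℤ.+ i) (ℤ.pos-* (m / n) n))
  ring : ∀ r s t n → r ℤ.+ s ℤ.* n ≡ r ℤ.+ t ℤ.* n ℤ.+ (s ℤ.- t) ℤ.* n
  ring = ℤ-Solver.solve-∀

≈⇒%≡% : ∀ {a b} n .{{_ : NonZero n}} → + a ≈ + b [mod + n ] → a % n ≡ b % n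
≈⇒%≡% {a} {b} n (by (+ k) eq) = trans (cong (_% n) a≡b+kn) ([m+kn]%n≡m%n b k n)
  where
  a≡b+kn : a ≡ b + k * n
  a≡b+kn = ℤ.+-injective (trans eq (cong (λ i → + b ℤ.+ i) (sym (ℤ.pos-* k n))))
-- With a negative quotient the reversed congruence has quotient `suc k`, so the equation again
-- lives in the natural numbers.
≈⇒%≡% {a} {b} n a≈b@(by -[1+ k ] _) =
  sym (trans (cong (_% n) b≡a+[1+k]n) ([m+kn]%n≡m%n a (suc k) n))
  where
  b≡a+[1+k]n : b ≡ a + suc k * n
  b≡a+[1+k]n = ℤ.+-injective (trans (_≈_[mod_].equality (≈-sym a≈b)) (cong (λ i → + a ℤ.+ i) (sym (ℤ.pos-* (suc k) n))))

≈-%ℕ : ∀ x n .{{_ : NonZero n}} → x ≈ + (x ℤ.%ℕ n) [mod + n ]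
≈-%ℕ x n = by (x ℤ./ℕ n) (ℤ.a≡a%ℕn+[a/ℕn]*n x n)

-- The products (a + 1)(a + 3)⋯(a + 2n - 1) and (a - 1)(a - 3)⋯(a - 2n + 1).

ascending : ℤ → ℕ → ℤ
ascending a zero    = 1ℤ
ascending a (suc n) = ascending a n ℤ.* (a ℤ.+ (1ℤ ℤ.+ + 2 ℤ.* + n))

descending : ℤ → ℕ → ℤ
descending a zero    = 1ℤ
descending a (suc n) = descending a n ℤ.* (a ℤ.- (1ℤ ℤ.+ + 2 ℤ.* + n))

ascending-+ : ∀ a n m → ascending a (n + m) ≡ ascending a m ℤ.* ascending (a ℤ.+ + 2 ℤ.* + m) n
ascending-+ a zero    m = sym (ℤ.*-identityʳ (ascending a m))
ascending-+ a (suc n) m = begin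
  ascending a (n + m) ℤ.* (a ℤ.+ (1ℤ ℤ.+ + 2 ℤ.* (+ n ℤ.+ + m)))
    ≡⟨ cong (ℤ._* (a ℤ.+ (1ℤ ℤ.+ + 2 ℤ.* (+ n ℤ.+ + m)))) (ascending-+ a n m) ⟩
  ascending a m ℤ.* ascending (a ℤ.+ + 2 ℤ.* + m) n ℤ.* (a ℤ.+ (1ℤ ℤ.+ + 2 ℤ.* (+ n ℤ.+ + m)))
    ≡⟨ ring (ascending a m) (ascending (a ℤ.+ + 2 ℤ.* + m) n) a (+ n) (+ m) ⟩
  ascending a m ℤ.* ascending (a ℤ.+ + 2 ℤ.* + m) (suc n) ∎
  where
  open ≡-Reasoning
  ring : ∀ p q a n m → p ℤ.* q ℤ.* (a ℤ.+ (1ℤ ℤ.+ + 2 ℤ.* (n ℤ.+ m)))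
                     ≡ p ℤ.* (q ℤ.* (a ℤ.+ + 2 ℤ.* m ℤ.+ (1ℤ ℤ.+ + 2 ℤ.* n)))
  ring = ℤ-Solver.solve-∀

-- The same factors, read downwards from the upper end a + 2n of their range.
ascending≡descending : ∀ a n → ascending a n ≡ descending (a ℤ.+ + 2 ℤ.* + n) n
ascending≡descending a zero    = refl
ascending≡descending a (suc n) = begin
  ascending a (suc n)
    ≡⟨ cong (ascending a) (+-comm 1 n) ⟩
  ascending a (n + 1)
    ≡⟨ ascending-+ a n 1 ⟩
  ascending a 1 ℤ.* ascending (a ℤ.+ + 2) n
    ≡⟨ cong (ascending a 1 ℤ.*_) (ascending≡descending (a ℤ.+ + 2) n) ⟩
  ascending a 1 ℤ.* descending (a ℤ.+ + 2 ℤ.+ + 2 ℤ.* + n) n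
    ≡⟨ cong (λ b → ascending a 1 ℤ.* descending b n) (shift a (+ n)) ⟩
  ascending a 1 ℤ.* descending (a ℤ.+ + 2 ℤ.* + suc n) n
    ≡⟨ ring a (+ n) (descending (a ℤ.+ + 2 ℤ.* + suc n) n) ⟩
  descending (a ℤ.+ + 2 ℤ.* + suc n) (suc n) ∎
  where
  open ≡-Reasoning
  shift : ∀ a n → a ℤ.+ + 2 ℤ.+ + 2 ℤ.* n ≡ a ℤ.+ + 2 ℤ.* (1ℤ ℤ.+ n)
  shift = ℤ-Solver.solve-∀
  ring : ∀ a n p → 1ℤ ℤ.* (a ℤ.+ (1ℤ ℤ.+ + 2 ℤ.* 0ℤ)) ℤ.* p
                 ≡ p ℤ.* (a ℤ.+ + 2 ℤ.* (1ℤ ℤ.+ n) ℤ.- (1ℤ ℤ.+ + 2 ℤ.* n))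
  ring = ℤ-Solver.solve-∀

-- (q + i) (2q - i) = i (q - i) + 2q²
pairwise-≈ : ∀ q n → ascending q n ℤ.* descending (q ℤ.+ q) n
                   ≈ ascending 0ℤ n ℤ.* descending q n [mod + 2 ℤ.* (q ℤ.* q) ]
pairwise-≈ q zero    = ≈-refl
pairwise-≈ q (suc n) =
  ≈-trans (≈-reflexive (interchange (ascending q n) _ (descending (q ℤ.+ q) n) _))
  (≈-trans (≈-* (pairwise-≈ q n) (by 1ℤ (pair q (1ℤ ℤ.+ + 2 ℤ.* + n))))
  (≈-reflexive (interchange (ascending 0ℤ n) (descending q n) _ _)))
  where
  interchange : ∀ a b c d → a ℤ.* b ℤ.* (c ℤ.* d) ≡ a ℤ.* c ℤ.* (b ℤ.* d)
  interchange = ℤ-Solver.solve-∀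
  pair : ∀ q i → (q ℤ.+ i) ℤ.* (q ℤ.+ q ℤ.- i)
               ≡ (0ℤ ℤ.+ i) ℤ.* (q ℤ.- i) ℤ.+ 1ℤ ℤ.* (+ 2 ℤ.* (q ℤ.* q))
  pair = ℤ-Solver.solve-∀

-- The upper half of the factors is read backwards, which puts each factor of the lower half
-- opposite its mirror image in the range from a to a + 4m.
ascending-double : ∀ a m →
  ascending a (m + m) ≡ ascending a m ℤ.* descending (a ℤ.+ + 4 ℤ.* + m) m
ascending-double a m = begin
  ascending a (m + m)
    ≡⟨ ascending-+ a m m ⟩
  ascending a m ℤ.* ascending (a ℤ.+ + 2 ℤ.* + m) m
    ≡⟨ cong (ascending a m ℤ.*_) (ascending≡descending (a ℤ.+ + 2 ℤ.* + m) m) ⟩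
  ascending a m ℤ.* descending (a ℤ.+ + 2 ℤ.* + m ℤ.+ + 2 ℤ.* + m) m
    ≡⟨ cong (λ b → ascending a m ℤ.* descending b m) (ring a (+ m)) ⟩
  ascending a m ℤ.* descending (a ℤ.+ + 4 ℤ.* + m) m ∎
  where
  open ≡-Reasoning
  ring : ∀ a m → a ℤ.+ + 2 ℤ.* m ℤ.+ + 2 ℤ.* m ≡ a ℤ.+ + 4 ℤ.* m
  ring = ℤ-Solver.solve-∀

-- Since q = 4m, the mirror pairs are q + i and 2q - i on the left, i and q - i on the right, as
-- `pairwise-≈` requires.
ascending-shift : ∀ m → let q = + 4 ℤ.* + m in
  ascending q (m + m) ≈ ascending 0ℤ (m + m) [mod + 2 ℤ.* (q ℤ.* q) ]
ascending-shift m =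
  ≈-trans (≈-reflexive (ascending-double q m))
  (≈-trans (pairwise-≈ q m)
  (≈-reflexive (begin
    ascending 0ℤ m ℤ.* descending q m
      ≡⟨ cong (λ b → ascending 0ℤ m ℤ.* descending b m) (ℤ.+-identityˡ q) ⟨
    ascending 0ℤ m ℤ.* descending (0ℤ ℤ.+ q) m
      ≡⟨ ascending-double 0ℤ m ⟨
    ascending 0ℤ (m + m) ∎)))
  where
  open ≡-Reasoning
  q = + 4 ℤ.* + m

oddFactorial≡ascending : ∀ n → + oddFactorial n ≡ ascending 0ℤ n
oddFactorial≡ascending zero    = refl
oddFactorial≡ascending (suc n) = begin
  + (oddFactorial n * (1 + 2 * n))
    ≡⟨ ℤ.pos-* (oddFactorial n) (1 + 2 * n) ⟩
  + oddFactorial n ℤ.* (1ℤ ℤ.+ + (2 * n))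
    ≡⟨ cong₂ (λ f t → f ℤ.* (1ℤ ℤ.+ t)) (oddFactorial≡ascending n) (ℤ.pos-* 2 n) ⟩
  ascending 0ℤ n ℤ.* (1ℤ ℤ.+ + 2 ℤ.* + n)
    ≡⟨ cong (ascending 0ℤ n ℤ.*_) (ℤ.+-identityˡ (1ℤ ℤ.+ + 2 ℤ.* + n)) ⟨
  ascending 0ℤ n ℤ.* (0ℤ ℤ.+ (1ℤ ℤ.+ + 2 ℤ.* + n)) ∎
  where open ≡-Reasoning

-- Products of all odd numbers below a power of 2.

O : ℕ → ℤ
O e = + oddFactorial (2 ^ e)

2^suc : ∀ k → + (2 ^ suc k) ≡ + 2 ℤ.* + (2 ^ k)
2^suc k = ℤ.pos-* 2 (2 ^ k)

-- The odd numbers below 2q split at q: the lower half gives `O (1 + e)`, and the upper half is its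
-- shift by q. The indices make q = 4 · 2ᵉ, the form that `ascending-shift` needs.
O-suc : ∀ e → let q = + (2 ^ (2 + e)) in
  O (2 + e) ≈ O (1 + e) ℤ.* O (1 + e) [mod + 2 ℤ.* (q ℤ.* q) ]
O-suc e =
  ≈-trans (≈-reflexive split)
  (subst (λ q → ascending 0ℤ n ℤ.* ascending q n ≈ O (1 + e) ℤ.* O (1 + e) [mod + 2 ℤ.* (q ℤ.* q) ]) (sym q≡4m)
    (≈-trans (≈-* (≈-refl {ascending 0ℤ n}) shifted)
    (≈-reflexive (sym (cong₂ ℤ._*_ (oddFactorial≡ascending n) (oddFactorial≡ascending n))))))
  where
  open ≡-Reasoning
  m = 2 ^ e
  n = 2 ^ suc e
  q≡4m : + (2 ^ (2 + e)) ≡ + 4 ℤ.* + m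
  q≡4m = trans (cong +_ (sym (*-assoc 2 2 m))) (ℤ.pos-* 4 m)
  2*n≡n+n : ∀ k → 2 * k ≡ k + k
  2*n≡n+n = ℕ-Solver.solve-∀
  split : O (2 + e) ≡ ascending 0ℤ n ℤ.* ascending (+ (2 ^ (2 + e))) n
  split = begin
    + oddFactorial (2 * n)
      ≡⟨ oddFactorial≡ascending (2 * n) ⟩
    ascending 0ℤ (2 * n)
      ≡⟨ cong (ascending 0ℤ) (2*n≡n+n n) ⟩
    ascending 0ℤ (n + n)
      ≡⟨ ascending-+ 0ℤ n n ⟩
    ascending 0ℤ n ℤ.* ascending (0ℤ ℤ.+ + 2 ℤ.* + n) n
      ≡⟨ cong (λ b → ascending 0ℤ n ℤ.* ascending b n)
           (trans (ℤ.+-identityˡ (+ 2 ℤ.* + n)) (sym (2^suc (suc e)))) ⟩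
    ascending 0ℤ n ℤ.* ascending (+ (2 ^ (2 + e))) n ∎
  q = + 4 ℤ.* + m
  shifted : ascending q n ≈ ascending 0ℤ n [mod + 2 ℤ.* (q ℤ.* q) ]
  shifted = subst (λ k → ascending q k ≈ ascending 0ℤ k [mod + 2 ℤ.* (q ℤ.* q) ])
    (sym (2*n≡n+n m)) (ascending-shift m)

-- Passing to the next index squares the value up to a much smaller error, and squaring a number
-- close to 1 gains one bit of precision.
O≈1 : ∀ e → O (2 + e) ≈ 1ℤ [mod + (2 ^ (3 + e)) ]
-- `O 2` is 1 · 3 · 5 · 7 = 105 = 1 + 13 · 8.
O≈1 zero    = by (+ 13) refl
O≈1 (suc e) = subst (λ n → O (3 + e) ≈ 1ℤ [mod n ]) (sym (2^suc (3 + e)))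
  (≈-trans
    (≈-factor {n = q} (subst (λ n → O (3 + e) ≈ O (2 + e) ℤ.* O (2 + e) [mod n ])
      (sym (ℤ.*-assoc (+ 2) q q)) (O-suc (suc e))))
    (subst (λ p → O (2 + e) ℤ.* O (2 + e) ≈ 1ℤ [mod + 2 ℤ.* p ]) (sym (2^suc (2 + e)))
      (≈1-square {h = + (2 ^ (2 + e))} (subst (λ n → O (2 + e) ≈ 1ℤ [mod n ]) (2^suc (2 + e)) (O≈1 e)))))
  where
  q = + (2 ^ (3 + e))
  ≈1-square : ∀ {x h} → x ≈ 1ℤ [mod + 2 ℤ.* h ] → x ℤ.* x ≈ 1ℤ [mod + 2 ℤ.* (+ 2 ℤ.* h) ]
  ≈1-square {_} {h} (by k refl) = by (k ℤ.+ k ℤ.* k ℤ.* h) (ring k h)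
    where
    ring : ∀ k h → (1ℤ ℤ.+ k ℤ.* (+ 2 ℤ.* h)) ℤ.* (1ℤ ℤ.+ k ℤ.* (+ 2 ℤ.* h))
                 ≡ 1ℤ ℤ.+ (k ℤ.+ k ℤ.* k ℤ.* h) ℤ.* (+ 2 ℤ.* (+ 2 ℤ.* h))
    ring = ℤ-Solver.solve-∀

-- The odd parts of (2ᵉ)! and their extrapolation.

A : ℕ → ℤ
A e = + od2^ e !

A-suc : ∀ e → A (suc e) ≡ A e ℤ.* O e
A-suc e = trans (cong +_ (od2^-suc e)) (ℤ.pos-* (od2^ e !) (oddFactorial (2 ^ e)))

A-step : ∀ e → 2 ≤ e → A (suc e) ≈ A e [mod + (2 ^ suc e) ]
A-step e@(suc (suc i)) (s≤s (s≤s _)) =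
  ≈-trans (≈-reflexive (A-suc e))
  (≈-trans (≈-* (≈-refl {A e}) (O≈1 i)) (≈-reflexive (ℤ.*-identityʳ (A e))))

-- Extrapolation doubles the 2-adic precision to which A e approximates the limit.
B : ℕ → ℤ
B e = + 2 ℤ.* A e ℤ.- A (suc e)

-- The two sides differ by a (x³ - 3x + 2) = a (x - 1)² (x + 2), up to the error in y.
extrapolation-stable : ∀ {a a′ a″ x y q} → a′ ≡ a ℤ.* x → a″ ≡ a′ ℤ.* y →
  x ≈ 1ℤ [mod q ] → y ≈ x ℤ.* x [mod + 2 ℤ.* (q ℤ.* q) ] →
  + 2 ℤ.* a′ ℤ.- a″ ≈ + 2 ℤ.* a ℤ.- a′ [mod q ℤ.* q ]
extrapolation-stable {a} {q = q} refl refl (by k refl) (by c refl) =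
  by (ℤ.- (a ℤ.* (k ℤ.* k ℤ.* (1ℤ ℤ.+ k ℤ.* q ℤ.+ + 2) ℤ.+ + 2 ℤ.* (1ℤ ℤ.+ k ℤ.* q) ℤ.* c))) (ring a k c q)
  where
  ring : ∀ a k c q → let x = 1ℤ ℤ.+ k ℤ.* q in
    + 2 ℤ.* (a ℤ.* x) ℤ.- a ℤ.* x ℤ.* (x ℤ.* x ℤ.+ c ℤ.* (+ 2 ℤ.* (q ℤ.* q)))
    ≡ + 2 ℤ.* a ℤ.- a ℤ.* x
      ℤ.+ ℤ.- (a ℤ.* (k ℤ.* k ℤ.* (x ℤ.+ + 2) ℤ.+ + 2 ℤ.* x ℤ.* c)) ℤ.* (q ℤ.* q)
  ring = ℤ-Solver.solve-∀

B-step : ∀ e → 2 ≤ e → B (suc e) ≈ B e [mod + (2 ^ (suc e + suc e)) ]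
B-step e@(suc (suc i)) (s≤s (s≤s _)) =
  subst (λ n → B (suc e) ≈ B e [mod n ]) (sym (2^-+ (suc e) (suc e)))
    (extrapolation-stable {A e} (A-suc e) (A-suc (suc e)) (O≈1 i) (O-suc (suc i)))

-- Binary digits and windows of bits.

mod2^-suc : ∀ n i → n mod2^ suc i ≡ n mod2^ i + bit n i * 2 ^ i
mod2^-suc n i = begin
  n % (2 ^ suc i)
    ≡⟨ cong (_% 2 ^ suc i) expand ⟩
  (r + b * 2 ^ i + t * 2 ^ suc i) % 2 ^ suc i
    ≡⟨ [m+kn]%n≡m%n (r + b * 2 ^ i) t (2 ^ suc i) ⟩
  (r + b * 2 ^ i) % 2 ^ suc i
    ≡⟨ m<n⇒m%n≡m small ⟩
  r + b * 2 ^ i ∎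
  where
  open ≡-Reasoning
  instance
    _ = m^n≢0 2 i
    _ = m^n≢0 2 (suc i)
  r = n mod2^ i
  b = bit n i
  t = n div2^ i / 2
  ring : ∀ r b t p → r + (b + t * 2) * p ≡ r + b * p + t * (2 * p)
  ring = ℕ-Solver.solve-∀
  expand : n ≡ r + b * 2 ^ i + t * 2 ^ suc i
  expand = begin
    n                               ≡⟨ m≡m%n+[m/n]*n n (2 ^ i) ⟩
    r + n div2^ i * 2 ^ i           ≡⟨ cong (λ m → r + m * 2 ^ i) (m≡m%n+[m/n]*n (n div2^ i) 2) ⟩
    r + (b + t * 2) * 2 ^ i         ≡⟨ ring r b t (2 ^ i) ⟩
    r + b * 2 ^ i + t * 2 ^ suc i   ∎
  small : r + b * 2 ^ i < 2 ^ suc i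
  -- The bit is at most 1, so the sum stays below 2ⁱ + 2ⁱ.
  small = +-mono-<-≤ (m%n<n n (2 ^ i))
    (*-monoˡ-≤ (2 ^ i) (s≤s⁻¹ (m%n<n (n div2^ i) 2)))

-- `applyUpTo` recurses at the lowest position, whereas windows are extended at the top.
stab-suc : ∀ z m d → stab z m (suc d) ≡ stab z m d + bit₂ z (m + d) * 2 ^ d
stab-suc z m d = begin
  sum (applyUpTo f (suc d))            ≡⟨ cong sum (applyUpTo-∷ʳ f d) ⟨
  sum (applyUpTo f d ++ f d ∷ [])      ≡⟨ sum-++ (applyUpTo f d) (f d ∷ []) ⟩
  sum (applyUpTo f d) + (f d + 0)      ≡⟨ cong (λ t → sum (applyUpTo f d) + t) (+-identityʳ (f d)) ⟩
  sum (applyUpTo f d) + f d            ∎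
  where
  open ≡-Reasoning
  f = λ i → bit₂ z (m + i) * 2 ^ i

-- Each step of the induction on `d` adds the bit in position m + d; `coherent` carries the
-- remaining bits down one level.
residue-split : ∀ z m d → residue z (m + d) mod2^ (m + d) ≡ residue z m mod2^ m + 2 ^ m * stab z m d
residue-split z m zero    rewrite +-identityʳ m | *-zeroʳ (2 ^ m) = sym (+-identityʳ _)
residue-split z m (suc d) rewrite +-suc m d = begin
  residue z (suc (m + d)) mod2^ suc (m + d)
    ≡⟨ mod2^-suc (residue z (suc (m + d))) (m + d) ⟩
  residue z (suc (m + d)) mod2^ (m + d) + bit₂ z (m + d) * 2 ^ (m + d)
    ≡⟨ cong₂ (λ r p → r + bit₂ z (m + d) * p)
         (trans (coherent z (m + d)) (residue-split z m d)) (^-distribˡ-+-* 2 m d) ⟩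
  residue z m mod2^ m + 2 ^ m * stab z m d + bit₂ z (m + d) * (2 ^ m * 2 ^ d)
    ≡⟨ ring (residue z m mod2^ m) (2 ^ m) (stab z m d) (bit₂ z (m + d)) (2 ^ d) ⟩
  residue z m mod2^ m + 2 ^ m * (stab z m d + bit₂ z (m + d) * 2 ^ d)
    ≡⟨ cong (λ s → residue z m mod2^ m + 2 ^ m * s) (stab-suc z m d) ⟨
  residue z m mod2^ m + 2 ^ m * stab z m (suc d) ∎
  where
  open ≡-Reasoning
  ring : ∀ r p s b q → r + p * s + b * (p * q) ≡ r + p * (s + b * q)
  ring = ℕ-Solver.solve-∀

≡₂⇒≈ : ∀ {x y} k → x ≡₂ y [mod2^ k ] → + residue x k ≈ + residue y k [mod + (2 ^ k) ]
≡₂⇒≈ {x} {y} k = %≡%⇒≈ (residue x k) (residue y k) (2 ^ k) {{m^n≢0 2 k}}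

≈⇒≡₂ : ∀ {x y} k → + residue x k ≈ + residue y k [mod + (2 ^ k) ] → x ≡₂ y [mod2^ k ]
≈⇒≡₂ k = ≈⇒%≡% (2 ^ k) {{m^n≢0 2 k}}

residue-≈ : ∀ z {k l} → k ≤ l → + residue z l ≈ + residue z k [mod + (2 ^ k) ]
residue-≈ z {k} {l} k≤l = subst (λ l → + residue z l ≈ + residue z k [mod + (2 ^ k) ]) (m∸n+n≡m k≤l)
  (≈-telescope (λ l → + residue z l) k
    (λ f k≤f → ≈-weaken k≤f (%≡%⇒≈ _ _ (2 ^ f) {{m^n≢0 2 f}} (coherent z f)))
    (l ∸ k))

-- Both residues share the bits below position m, so only the windows differ.
window-difference : ∀ x y m d → x ≡₂ y [mod2^ m ] →
  + residue x (m + d)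
  ≈ + residue y (m + d) ℤ.+ + (2 ^ m) ℤ.* (+ stab x m d ℤ.- + stab y m d) [mod + (2 ^ (m + d)) ]
window-difference x y m d x≡y =
  ≈-trans (≈-sym (reduce x))
  (≈-trans (≈-reflexive (begin
    + (residue x m mod2^ m + 2 ^ m * stab x m d)
      ≡⟨ cong (λ i → + (residue x m mod2^ m) ℤ.+ i) (ℤ.pos-* (2 ^ m) (stab x m d)) ⟩
    + (residue x m mod2^ m) ℤ.+ + (2 ^ m) ℤ.* + stab x m d
      ≡⟨ cong (λ r → + r ℤ.+ + (2 ^ m) ℤ.* + stab x m d) x≡y ⟩
    + (residue y m mod2^ m) ℤ.+ + (2 ^ m) ℤ.* + stab x m d
      ≡⟨ ring (+ (residue y m mod2^ m)) (+ (2 ^ m)) (+ stab x m d) (+ stab y m d) ⟩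
    + (residue y m mod2^ m) ℤ.+ + (2 ^ m) ℤ.* + stab y m d ℤ.+ Δ
      ≡⟨ cong (λ t → + (residue y m mod2^ m) ℤ.+ t ℤ.+ Δ) (ℤ.pos-* (2 ^ m) (stab y m d)) ⟨
    + (residue y m mod2^ m + 2 ^ m * stab y m d) ℤ.+ Δ ∎))
  (≈-+ (reduce y) (≈-refl {Δ})))
  where
  open ≡-Reasoning
  Δ = + (2 ^ m) ℤ.* (+ stab x m d ℤ.- + stab y m d)
  ring : ∀ r p s t → r ℤ.+ p ℤ.* s ≡ r ℤ.+ p ℤ.* t ℤ.+ p ℤ.* (s ℤ.- t)
  ring = ℤ-Solver.solve-∀
  reduce : ∀ w → + (residue w m mod2^ m + 2 ^ m * stab w m d) ≈ + residue w (m + d) [mod + (2 ^ (m + d)) ]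
  reduce w = %≡%⇒≈ _ _ (2 ^ (m + d)) (begin
    (residue w m mod2^ m + 2 ^ m * stab w m d) % 2 ^ (m + d)
      ≡⟨ cong (_% 2 ^ (m + d)) (residue-split w m d) ⟨
    residue w (m + d) % 2 ^ (m + d) % 2 ^ (m + d)
      ≡⟨ m%n%n≡m%n (residue w (m + d)) (2 ^ (m + d)) ⟩
    residue w (m + d) % 2 ^ (m + d) ∎)
    where instance _ = m^n≢0 2 (m + d)

-- Subtract twice the first congruence from the second and divide by 2p.
cancel-doubled : ∀ {p t a a′ D D′ r r′} .{{_ : ℤ.NonZero p}} →
  r  ≈ a ℤ.+ p ℤ.* D [mod p ℤ.* t ] →
  r′ ≈ a′ ℤ.+ + 2 ℤ.* p ℤ.* D′ [mod + 2 ℤ.* (p ℤ.* t) ] →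
  r′ ≈ r [mod p ℤ.* t ] →
  + 2 ℤ.* a ℤ.- a′ ≈ r′ [mod + 2 ℤ.* (p ℤ.* t) ] →
  D′ ≈ D [mod t ]
cancel-doubled {p} {t} {a} {a′} {D} {D′} {r} {r′} (by c₁ eq₁) (by c₂ eq₂) (by c₃ eq₃) (by c₄ eq₄) =
  by (c₁ ℤ.- c₂ ℤ.+ c₃ ℤ.+ c₄) (ℤ.*-cancelˡ-≡ (+ 2 ℤ.* p) _ _ {{ℤ.i*j≢0 (+ 2) p}} (begin
    + 2 ℤ.* p ℤ.* D′
      ≡⟨ ring₁ p t a a′ D′ c₂ ⟩
    + 2 ℤ.* a ℤ.- a′ ℤ.+ (a′ ℤ.+ + 2 ℤ.* p ℤ.* D′ ℤ.+ c₂ ℤ.* (+ 2 ℤ.* (p ℤ.* t)))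
      ℤ.- + 2 ℤ.* a ℤ.- c₂ ℤ.* (+ 2 ℤ.* (p ℤ.* t))
      ≡⟨ cong₂ (λ x y → x ℤ.+ y ℤ.- + 2 ℤ.* a ℤ.- c₂ ℤ.* (+ 2 ℤ.* (p ℤ.* t))) eq₄ (sym eq₂) ⟩
    r′ ℤ.+ c₄ ℤ.* (+ 2 ℤ.* (p ℤ.* t)) ℤ.+ r′ ℤ.- + 2 ℤ.* a ℤ.- c₂ ℤ.* (+ 2 ℤ.* (p ℤ.* t))
      ≡⟨ cong (λ x → x ℤ.+ c₄ ℤ.* (+ 2 ℤ.* (p ℤ.* t)) ℤ.+ x ℤ.- + 2 ℤ.* a ℤ.- c₂ ℤ.* (+ 2 ℤ.* (p ℤ.* t)))
           (trans eq₃ (cong (λ x → x ℤ.+ c₃ ℤ.* (p ℤ.* t)) eq₁)) ⟩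
    _
      ≡⟨ ring₂ p t a D c₁ c₂ c₃ c₄ ⟩
    + 2 ℤ.* p ℤ.* (D ℤ.+ (c₁ ℤ.- c₂ ℤ.+ c₃ ℤ.+ c₄) ℤ.* t) ∎))
  where
  open ≡-Reasoning
  ring₁ : ∀ p t a a′ D′ c₂ →
    + 2 ℤ.* p ℤ.* D′
    ≡ + 2 ℤ.* a ℤ.- a′ ℤ.+ (a′ ℤ.+ + 2 ℤ.* p ℤ.* D′ ℤ.+ c₂ ℤ.* (+ 2 ℤ.* (p ℤ.* t)))
      ℤ.- + 2 ℤ.* a ℤ.- c₂ ℤ.* (+ 2 ℤ.* (p ℤ.* t))
  ring₁ = ℤ-Solver.solve-∀
  ring₂ : ∀ p t a D c₁ c₂ c₃ c₄ →
    let r′ = a ℤ.+ p ℤ.* D ℤ.+ c₁ ℤ.* (p ℤ.* t) ℤ.+ c₃ ℤ.* (p ℤ.* t) in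
    r′ ℤ.+ c₄ ℤ.* (+ 2 ℤ.* (p ℤ.* t)) ℤ.+ r′ ℤ.- + 2 ℤ.* a ℤ.- c₂ ℤ.* (+ 2 ℤ.* (p ℤ.* t))
    ≡ + 2 ℤ.* p ℤ.* (D ℤ.+ (c₁ ℤ.- c₂ ℤ.+ c₃ ℤ.+ c₄) ℤ.* t)
  ring₂ = ℤ-Solver.solve-∀

-- The limit z and the constant K.

module Limit (z : ℤ₂) (limit : z IsLimitOf od2^_!) where

  -- Convergence only controls `A f` for large f; telescoping `A-step` carries the congruence from
  -- such an index back to e.
  A≈z : ∀ e → 2 ≤ e → A e ≈ + residue z (suc e) [mod + (2 ^ suc e) ]
  A≈z e 2≤e with N , close ← limit (suc e) =
    ≈-trans
      (≈-sym (≈-telescope A e (λ f e≤f → ≈-weaken (s≤s e≤f) (A-step f (≤-trans 2≤e e≤f))) N))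
      (≡₂⇒≈ {fromℕ _} {z} (suc e) (close (N + e) (m≤m+n N e)))

  -- `B f` tends to 2z - z = z, and modulo this power of 2 it is constant from index e on.
  B≈z : ∀ e → 2 ≤ e → B e ≈ + residue z (suc e + suc e) [mod + (2 ^ (suc e + suc e)) ]
  B≈z e 2≤e with N , close ← limit (suc e + suc e) =
    ≈-trans
      (≈-sym (≈-telescope B e
        (λ f e≤f → ≈-weaken (+-mono-≤ (s≤s e≤f) (s≤s e≤f)) (B-step f (≤-trans 2≤e e≤f))) N))
      (≈-trans
        (≈-+ (≈-* (≈-refl {+ 2}) (A-close (N + e) (m≤m+n N e)))
             (≈-neg (A-close (suc (N + e)) (m≤n⇒m≤1+n (m≤m+n N e)))))
        (≈-reflexive (ring (+ residue z (suc e + suc e)))))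
    where
    A-close : ∀ f → N ≤ f → A f ≈ + residue z (suc e + suc e) [mod + (2 ^ (suc e + suc e)) ]
    A-close f N≤f = ≡₂⇒≈ {fromℕ _} {z} (suc e + suc e) (close f N≤f)
    ring : ∀ r → + 2 ℤ.* r ℤ.- r ≡ r
    ring = ℤ-Solver.solve-∀

  -- The candidate for K modulo 2ᵈ, taken in the integers because the difference may be negative.
  D : ℕ → ℕ → ℤ
  D e d = + stab z (e + 1) d ℤ.- + uns e d

  z≈A+D : ∀ e d → 2 ≤ e →
    + residue z (suc e + d) ≈ A e ℤ.+ + (2 ^ suc e) ℤ.* D e d [mod + (2 ^ (suc e + d)) ]
  z≈A+D e d 2≤e = subst
    (λ m → + residue z (m + d) ≈ A e ℤ.+ + (2 ^ m) ℤ.* D e d [mod + (2 ^ (m + d)) ])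
    (+-comm e 1)
    -- By unfolding, `uns e d` is the window `stab` of the constant `fromℕ (od2^ e !)`.
    (window-difference z (fromℕ (od2^ e !)) (e + 1) d
      (subst (λ m → z ≡₂ fromℕ (od2^ e !) [mod2^ m ]) (+-comm 1 e)
        (≈⇒≡₂ {z} {fromℕ (od2^ e !)} (suc e) (≈-sym (A≈z e 2≤e)))))

  -- `z≈A+D` at e and at e + 1 expresses z through the two differences. Since z ≡ 2 `A e` -
  -- `A (suc e)` to sufficient precision, the odd parts cancel, leaving 2ᵉ⁺² times the difference of
  -- the two `D` values.
  D-step : ∀ e d → 2 ≤ e → d < e → D (suc e) d ≈ D e d [mod + (2 ^ d) ]
  D-step e d 2≤e d<e = cancel-doubled {+ (2 ^ suc e)} {a = A e} {A (suc e)} {{m^n≢0 2 (suc e)}}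
    (subst (λ n → + residue z (suc e + d) ≈ A e ℤ.+ + (2 ^ suc e) ℤ.* D e d [mod n ])
      (2^-+ (suc e) d) (z≈A+D e d 2≤e))
    (subst₂ (λ p n → + residue z (2 + e + d) ≈ A (suc e) ℤ.+ p ℤ.* D (suc e) d [mod n ])
      (2^suc (suc e)) modulus (z≈A+D (suc e) d (m≤n⇒m≤1+n 2≤e)))
    (subst (λ n → + residue z (2 + e + d) ≈ + residue z (suc e + d) [mod n ])
      (2^-+ (suc e) d) (residue-≈ z (n≤1+n (suc e + d))))
    (subst (λ n → B e ≈ + residue z (2 + e + d) [mod n ])
      modulus (≈-trans (≈-weaken 2+e+d≤ (B≈z e 2≤e)) (residue-≈ z 2+e+d≤)))
    where
    modulus : + (2 ^ (2 + e + d)) ≡ + 2 ℤ.* (+ (2 ^ suc e) ℤ.* + (2 ^ d))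
    modulus = trans (2^suc (suc e + d)) (cong (+ 2 ℤ.*_) (2^-+ (suc e) d))
    2+e+d≤ : 2 + e + d ≤ suc e + suc e
    -- Here d < e enters: the window for e + 1 ends within the 2(e + 1) bits of z that `B≈z`
    -- determines.
    2+e+d≤ = ≤-trans (≤-reflexive (sym (+-suc (suc e) d))) (+-monoʳ-≤ (suc e) (m≤n⇒m≤1+n d<e))

  D-stable : ∀ d e → 0 < d → d < e → D e d ≈ D (suc d) d [mod + (2 ^ d) ]
  D-stable d e 0<d d<e = subst (λ f → D f d ≈ D (suc d) d [mod + (2 ^ d) ]) (m∸n+n≡m d<e)
    (≈-telescope (λ f → D f d) (suc d)
      -- From 0 < d < f follows the bound 2 ≤ f.
      (λ f d<f → D-step f d (≤-trans (s≤s 0<d) d<f) d<f) (e ∸ suc d))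

  stab-prefix : ∀ w m d → + stab w m (suc d) ≈ + stab w m d [mod + (2 ^ d) ]
  stab-prefix w m d = by (+ bit₂ w (m + d)) (trans (cong +_ (stab-suc w m d))
    (cong (λ i → + stab w m d ℤ.+ i) (ℤ.pos-* (bit₂ w (m + d)) (2 ^ d))))

  -- Lengthening both windows by one bit changes each of them by a multiple of 2ᵈ.
  D-prefix : ∀ e d → D e (suc d) ≈ D e d [mod + (2 ^ d) ]
  D-prefix e d = ≈-+ (stab-prefix z (e + 1) d) (≈-neg (stab-prefix (fromℕ (od2^ e !)) (e + 1) d))

  -- The nonnegative remainder of `D` at e = d + 1, the first index with e > d.
  K-residue : ℕ → ℕ
  K-residue d = ℤ._%ℕ_ (D (suc d) d) (2 ^ d) {{m^n≢0 2 d}}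

  D≈K : ∀ d → D (suc d) d ≈ + K-residue d [mod + (2 ^ d) ]
  D≈K d = ≈-%ℕ (D (suc d) d) (2 ^ d) {{m^n≢0 2 d}}

  K : ℤ₂
  residue K = K-residue
  -- Level 0 is treated apart, since `D-stable` assumes 0 < d; modulo 1 all residues vanish.
  coherent K zero = trans (n%1≡0 (K-residue 1)) (sym (n%1≡0 (K-residue 0)))
  -- First the window is shortened at the fixed index d + 3, then the index is lowered to d + 2,
  -- where `K-residue (suc d)` is defined.
  coherent K (suc d) = ≈⇒%≡% (2 ^ suc d) {{m^n≢0 2 (suc d)}}
    (≈-trans (≈-weaken (n≤1+n (suc d)) (≈-sym (D≈K (2 + d))))
    (≈-trans (D-prefix (3 + d) (suc d))
    (≈-trans (D-stable (suc d) (3 + d) z<s (n≤1+n (2 + d)))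
    (D≈K (suc d)))))

  uns+K≡stab : ∀ d e → 0 < d → d < e →
    fromℕ (uns e d) +₂ K ≡₂ fromℕ (stab z (e + 1) d) [mod2^ d ]
  uns+K≡stab d e 0<d d<e = ≈⇒%≡% (2 ^ d) {{m^n≢0 2 d}}
    (≈-trans (≈-+ (≈-refl {+ uns e d}) (≈-trans (≈-sym (D≈K d)) (≈-sym (D-stable d e 0<d d<e))))
    (≈-reflexive (ring (+ uns e d) (+ stab z (e + 1) d))))
    where
    ring : ∀ u s → u ℤ.+ (s ℤ.- u) ≡ s
    ring = ℤ-Solver.solve-∀

theorem1p1 : (z : ℤ₂) → z IsLimitOf od2^_! →
    ∃[ K ] (∀ d e → 0 < d → d < e →
    fromℕ (uns e d) +₂ K ≡₂ fromℕ (stab z (e + 1) d) [mod2^ d ])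
theorem1p1 z limit = K , uns+K≡stab
  where open Limit z limit
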